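{- For every fixed positive integer $k \geq 2$, $$\liminf_{\substack{|T| \to \infty \\ T\text{ topological tree}}}\big(\gamma(C_k,T) +\gamma(F^2_k,T)\big) \geq \frac{1}{\binom{1+(k-1)^{k-2}}{k}} \geq \frac{k!}{\big( 1+(k-1)^{k-2}\big)^k}.$$
   Context: A topological tree is a finite rooted tree in which every non-leaf vertex has outdegree (number of children) at least $2$; the single-vertex tree is allowed, its vertex being both root and leaf. Trees are considered up to isomorphism of rooted trees (unordered, unlabelled). $|T|$ denotes the number of leaves of $T$. A nonempty set $L$ of leaves of $T$ induces a topological tree: take the smallest subtree of $T$ connecting the leaves in $L$, rooted at the most recent common ancestor of $L$, and suppress (erase, joining the neighbours) all vertices of outdegree $1$. For topological trees $S,T$, $c(S,T)$ is the number of subsets of the leaf set of $T$ whose induced tree is isomorphic, as a rooted tree, to $S$, and $\gamma(S,T)=c(S,T)/\binom{|T|}{|S|}$ (for $|T|\ge |S|$). $C_k$ denotes the star with $k$ leaves, i.e. the topological tree whose $k$ leaves are all children of the root. $F^2_k$ denotes the binary caterpillar with $k$ leaves, i.e. the topological tree with $k$ leaves in which every non-leaf vertex has exactly two children and all non-leaf vertices lie on a single path starting at the root. The limit inferior over topological trees with $|T|\to\infty$ means $\liminf_{n\to\infty}\min_{|T|=n}(\cdot)$, the minimum being over all topological trees $T$ with $n$ leaves. -}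

module Defs where

open import Data.Fin as Fin using (Fin; zero; suc)
open import Data.Fin.Permutation as Perm using (Permutation; _⟨$⟩ʳ_)
open import Data.Fin.Properties using (any?)
open import Data.Fin.Subset using (Subset; inside; outside)
open import Data.Integer using (+_)
open import Data.List using (List; []; _∷_; _++_; map; length; lookup; filter;
  replicate; fromMaybe; cartesianProductWith)
import Data.List.Extrema as Extrema
open import Data.List.Membership.Propositional using (_∈_)
open import Data.List.Membership.Propositional.Properties
  using (∈-map⁺; ∈-filter⁺; ∈-cartesianProductWith⁺)
open import Data.List.Relation.Unary.All as All using (All; []; _∷_)
open import Data.List.Relation.Unary.All.Properties using (all-filter)
open import Data.List.Relation.Unary.Any using (here; there)
open import Data.Maybe using (Maybe; just; nothing)
import Data.Maybe as Maybe
open import Data.Maybe.Relation.Unary.Any as MaybeAny using ()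
open import Data.Nat using (ℕ; zero; suc; _+_; _*_; _≤_; _≤?_; _≟_; z≤n; s≤s; NonZero)
open import Data.Nat.Combinatorics using (_C_)
open import Data.Nat.Properties using (≤-refl; ≤-trans; m≤m+n; m≤n+m;
  +-mono-≤; +-identityʳ; *-distribˡ-+; module ≤-Reasoning)
open import Data.Nat.Tactic.RingSolver using (solve-∀)
open import Data.Product using (Σ-syntax; ∃-syntax; _×_; _,_)
open import Data.Rational as ℚ using (ℚ; 0ℚ)
open import Data.Rational.Properties using (≤-decTotalOrder)
open import Data.Vec using ([]; _∷_; take; drop)
import Data.Vec as Vec
open import Relation.Binary.PropositionalEquality
  using (_≡_; refl; sym; trans; cong; subst)
open import Relation.Binary.Bundles using (module DecTotalOrder)
open import Relation.Nullary using (Dec; yes; no)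
open import Relation.Nullary.Decidable using (_×-dec_; map′)

open Extrema (DecTotalOrder.totalOrder ≤-decTotalOrder)
  using (argmin; argmin-all; f[argmin]≤f[xs])

------------------------------------------------------------------------
-- Rooted trees

-- Children are stored in a list; their order is disregarded through _≅_.
data RootedTree : Set where
  vertex : List RootedTree → RootedTree

leaf : RootedTree
leaf = vertex []

mutual
  ∣_∣ : RootedTree → ℕ
  ∣ vertex []       ∣ = 1
  ∣ vertex (t ∷ ts) ∣ = ∣ t ∷ ts ∣ₗ

  ∣_∣ₗ : List RootedTree → ℕ
  ∣ []     ∣ₗ = 0
  ∣ t ∷ ts ∣ₗ = ∣ t ∣ + ∣ ts ∣ₗ

data Topological : RootedTree → Set where
  isLeaf : Topological leaf
  branch : ∀ {ts} → 2 ≤ length ts → All Topological ts → Topological (vertex ts)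

-- An isomorphism of rooted trees is a bijection between the children of the
-- two roots together with isomorphisms of the corresponding subtrees.
infix 4 _≅_ _≅?_

data _≅_ : RootedTree → RootedTree → Set where
  iso : ∀ {ts us} (π : Permutation (length ts) (length us)) →
        (∀ i → lookup ts i ≅ lookup us (π ⟨$⟩ʳ i)) → vertex ts ≅ vertex us

private
  Matching : ∀ {m n} → (Fin m → Fin n → Set) → Set
  Matching {m} {n} R = Σ[ π ∈ Permutation m n ] (∀ i → R i (π ⟨$⟩ʳ i))

  matching? : ∀ {m n} {R : Fin m → Fin n → Set} →
              (∀ i j → Dec (R i j)) → Dec (Matching R)
  matching? {zero}  {zero}  R? = yes (Perm.id , λ ())
  matching? {zero}  {suc n} R? = no λ (π , _) → Perm.refute (λ ()) π
  matching? {suc m} {zero}  R? = no λ (π , _) → Perm.refute (λ ()) π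
  matching? {suc m} {suc n} {R} R? =
    map′ extend restrict
      (any? λ j → R? zero j ×-dec matching? (λ i k → R? (suc i) (Fin.punchIn j k)))
    where
    Step = ∃[ j ] (R zero j × Matching (λ i k → R (suc i) (Fin.punchIn j k)))

    extend : Step → Matching R
    extend (j , r , π , rs) = Perm.insert zero j π , λ where
      zero    → r
      (suc i) → subst (R (suc i)) (sym (Perm.insert-punchIn zero j π i)) (rs i)

    restrict : Matching R → Step
    restrict (π , rs) = π ⟨$⟩ʳ zero , rs zero , Perm.remove zero π ,
      λ i → subst (R (suc i)) (Perm.punchIn-permute π zero i) (rs (suc i))

mutual
  _≅?_ : ∀ t u → Dec (t ≅ u)
  vertex ts ≅? vertex us =
    map′ (λ (π , is) → iso π is) (λ { (iso π is) → π , is })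
      (matching? λ i j → lookup≅? ts i (lookup us j))

  private
    lookup≅? : ∀ ts i u → Dec (lookup ts i ≅ u)
    lookup≅? (t ∷ ts) zero    u = t ≅? u
    lookup≅? (t ∷ ts) (suc i) u = lookup≅? ts i u

------------------------------------------------------------------------
-- Induced trees

-- A set of leaves of T is a Subset ∣ T ∣, the leaves being numbered from left
-- to right.

-- The union of the paths from the root to the leaves in L, if L is nonempty.
mutual
  rootPaths : ∀ T → Subset ∣ T ∣ → Maybe RootedTree
  rootPaths (vertex [])       (inside  ∷ []) = just leaf
  rootPaths (vertex [])       (outside ∷ []) = nothing
  rootPaths (vertex (t ∷ ts)) L with rootPathsₗ (t ∷ ts) L
  ... | []     = nothing
  ... | u ∷ us = just (vertex (u ∷ us))

  rootPathsₗ : ∀ ts → Subset ∣ ts ∣ₗ → List RootedTree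
  rootPathsₗ []       _ = []
  rootPathsₗ (t ∷ ts) L =
    fromMaybe (rootPaths t (take ∣ t ∣ L)) ++ rootPathsₗ ts (drop ∣ t ∣ L)

-- In the union of the root-to-leaf paths, the most recent common ancestor is
-- the first vertex from the root whose outdegree is not 1.
rerootAtMRCA : RootedTree → RootedTree
rerootAtMRCA (vertex (t ∷ [])) = rerootAtMRCA t
rerootAtMRCA t                 = t

mutual
  suppress : RootedTree → RootedTree
  suppress (vertex [])           = leaf
  suppress (vertex (t ∷ []))     = suppress t
  suppress (vertex (t ∷ u ∷ us)) = vertex (suppress t ∷ suppress u ∷ suppressₗ us)

  suppressₗ : List RootedTree → List RootedTree
  suppressₗ []       = []
  suppressₗ (t ∷ ts) = suppress t ∷ suppressₗ ts

induced : ∀ T → Subset ∣ T ∣ → Maybe RootedTree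
induced T L = Maybe.map (λ t → suppress (rerootAtMRCA t)) (rootPaths T L)

Induces : ∀ T → Subset ∣ T ∣ → RootedTree → Set
Induces T L S = MaybeAny.Any (_≅ S) (induced T L)

induces? : ∀ T L S → Dec (Induces T L S)
induces? T L S = MaybeAny.dec (_≅? S) (induced T L)

subsets : ∀ n → List (Subset n)
subsets zero    = [] ∷ []
subsets (suc n) = map (outside Vec.∷_) (subsets n) ++ map (inside Vec.∷_) (subsets n)

c : RootedTree → RootedTree → ℕ
c S T = length (filter (λ L → induces? T L S) (subsets ∣ T ∣))

-- Totalised by m ÷ 0 = 0.
infixl 7 _÷_
_÷_ : ℕ → ℕ → ℚ
m ÷ zero  = 0ℚ
m ÷ suc n = + m ℚ./ suc n

-- The denominator is nonzero precisely when ∣ S ∣ ≤ ∣ T ∣.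
γ : RootedTree → RootedTree → ℚ
γ S T = c S T ÷ (∣ T ∣ C ∣ S ∣)

-- C_k, for k ≥ 2.
star : ℕ → RootedTree
star k = vertex (replicate k leaf)

-- F²_k, for k ≥ 1.
caterpillar : ℕ → RootedTree
caterpillar (suc (suc k)) = vertex (leaf ∷ caterpillar (suc k) ∷ [])
caterpillar _             = leaf

------------------------------------------------------------------------
-- Minimum over the topological trees with n leaves

TopologicalWith : ℕ → RootedTree → Set
TopologicalWith n T = Topological T × ∣ T ∣ ≡ n

IsMinimum : (RootedTree → ℚ) → ℕ → ℚ → Set
IsMinimum f n m =
  (∃[ T ] (TopologicalWith n T × f T ≡ m)) × (∀ T → TopologicalWith n T → m ℚ.≤ f T)

mutual
  topological? : ∀ T → Dec (Topological T)
  topological? (vertex [])       = yes isLeaf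
  topological? (vertex (t ∷ ts)) =
    map′ (λ (l , a) → branch l a) (λ { (branch l a) → l , a })
      ((2 ≤? length (t ∷ ts)) ×-dec allTopological? (t ∷ ts))

  private
    allTopological? : ∀ ts → Dec (All Topological ts)
    allTopological? []       = yes []
    allTopological? (t ∷ ts) =
      map′ (λ (p , ps) → p ∷ ps) (λ { (p ∷ ps) → p , ps })
        (topological? t ×-dec allTopological? ts)

topologicalWith? : ∀ n T → Dec (TopologicalWith n T)
topologicalWith? n T = topological? T ×-dec (∣ T ∣ ≟ n)

-- forests d contains every forest with at most d vertices.
forests : ℕ → List (List RootedTree)
forests zero    = [] ∷ []
forests (suc d) =
  [] ∷ cartesianProductWith _∷_ (map vertex (forests d)) (forests d)

-- A topological tree with n leaves has fewer than 2 n non-root vertices.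
topologicalTrees : ℕ → List RootedTree
topologicalTrees n = filter (topologicalWith? n) (map vertex (forests (2 * n)))

-- For n ≥ 1 the value is the minimum, by minimum-isMinimum below; there is no
-- tree with 0 leaves.
minimum : (RootedTree → ℚ) → ℕ → ℚ
minimum f n = f (argmin f (caterpillar n) (topologicalTrees n))

private
  vertices : List RootedTree → ℕ
  vertices []               = 0
  vertices (vertex us ∷ ts) = suc (vertices us + vertices ts)

  ∈-forests : ∀ d ts → vertices ts ≤ d → ts ∈ forests d
  ∈-forests zero    []               _         = here refl
  ∈-forests zero    (vertex _ ∷ _)   ()
  ∈-forests (suc d) []               _         = here refl
  ∈-forests (suc d) (vertex us ∷ ts) (s≤s u+t≤d) = there
    (∈-cartesianProductWith⁺ _∷_
      (∈-map⁺ vertex (∈-forests d us (≤-trans (m≤m+n _ _) u+t≤d)))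
      (∈-forests d ts (≤-trans (m≤n+m _ (vertices us)) u+t≤d)))

  mutual
    vertices-bound : ∀ {ts} → Topological (vertex ts) →
                     2 + vertices ts ≤ 2 * ∣ vertex ts ∣
    vertices-bound isLeaf = ≤-refl
    vertices-bound {ts@(_ ∷ _)} (branch 2≤l tops) =
      ≤-trans (+-mono-≤ 2≤l (≤-refl {vertices ts})) (vertices-boundₗ tops)

    vertices-boundₗ : ∀ {ts} → All Topological ts →
                      length ts + vertices ts ≤ 2 * ∣ ts ∣ₗ
    vertices-boundₗ [] = z≤n
    vertices-boundₗ {vertex us ∷ ts} (top ∷ tops) = begin
      suc (length ts) + suc (vertices us + vertices ts)
        ≡⟨ regroup (length ts) (vertices us) (vertices ts) ⟩
      (2 + vertices us) + (length ts + vertices ts)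
        ≤⟨ +-mono-≤ (vertices-bound top) (vertices-boundₗ tops) ⟩
      2 * ∣ vertex us ∣ + 2 * ∣ ts ∣ₗ
        ≡⟨ *-distribˡ-+ 2 ∣ vertex us ∣ ∣ ts ∣ₗ ⟨
      2 * ∣ vertex us ∷ ts ∣ₗ ∎
      where
      open ≤-Reasoning
      regroup : ∀ l u v → suc l + suc (u + v) ≡ (2 + u) + (l + v)
      regroup = solve-∀

∈-topologicalTrees : ∀ {n} T → TopologicalWith n T → T ∈ topologicalTrees n
∈-topologicalTrees (vertex ts) (top , refl) =
  ∈-filter⁺ (topologicalWith? _)
    (∈-map⁺ vertex (∈-forests _ ts
      (≤-trans (m≤n+m (vertices ts) 2) (vertices-bound top))))
    (top , refl)

caterpillar-topological : ∀ n .{{_ : NonZero n}} → TopologicalWith n (caterpillar n)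
caterpillar-topological (suc zero)    = isLeaf , refl
caterpillar-topological (suc (suc n)) with caterpillar-topological (suc n)
... | top , eq = branch ≤-refl (isLeaf ∷ top ∷ []) ,
                 cong suc (trans (+-identityʳ _) eq)

minimum-isMinimum : ∀ f n .{{_ : NonZero n}} → IsMinimum f n (minimum f n)
minimum-isMinimum f n =
  (_ , argmin-all f (caterpillar-topological n) trees-topological , refl) ,
  λ T top → All.lookup (f[argmin]≤f[xs] (caterpillar n) (topologicalTrees n))
                       (∈-topologicalTrees T top)
  where
  trees-topological : All (TopologicalWith n) (topologicalTrees n)
  trees-topological = all-filter (topologicalWith? n) (map vertex (forests (2 * n)))

------------------------------------------------------------------------
-- Limit inferior

-- The limit inferior of a rational sequence is a possibly irrational (or
-- infinite) number, represented by its lower cut: as liminf a is the supremum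
-- over N of inf { a n | n ≥ N }, a rational q lies strictly below it iff
-- some q′ > q is a lower bound of a tail of a.
infix 4 _<liminf_ _≤liminf_

_<liminf_ : ℚ → (ℕ → ℚ) → Set
q <liminf a = ∃[ q′ ] (q ℚ.< q′ × ∃[ N ] (∀ n → N ≤ n → q′ ℚ.≤ a n))

_≤liminf_ : ℚ → (ℕ → ℚ) → Set
r ≤liminf a = ∀ q → q ℚ.< r → q <liminf a

{-# OPTIONS --safe #-}
module Submission where

-- With m = k − 1: a tree whose outdegrees are at most m and whose height is at
-- most m − 1 has at most m ^ (m − 1) leaves.  So any N = 1 + m ^ (m − 1) leaves
-- of T either meet k children of one vertex, and contain a star C_k, or have a
-- root path with m branchings, and contain a caterpillar F²_k.  Averaging over
-- the N-sets of leaves, at least a fraction 1 / (N C k) of the k-sets of leaves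
-- of T induces one of the two trees.

open import Defs
open import Data.Bool as Bool using (true; false; f≤t; b≤b)
open import Data.Fin using (zero; suc)
open import Data.Fin.Permutation as Perm using ()
open import Data.Fin.Subset using (Subset; inside; outside; ⊥) renaming (∣_∣ to ♯_)
open import Data.Fin.Subset.Properties using (∣⊥∣≡0)
open import Data.Integer as ℤ using (+_)
import Data.Integer.Properties as ℤ
import Data.Integer.Tactic.RingSolver as ℤ-Solver
open import Data.List as List using (List; []; _∷_; length; replicate; filter)
open import Data.List.Properties using (filter-++; length-++)
open import Data.List.Relation.Binary.Pointwise as Listwise using ([]; _∷_)
open import Data.List.Relation.Unary.All using (All; []; _∷_)
open import Data.Maybe using (just; nothing)
open import Data.Maybe.Relation.Unary.Any as MaybeAny using (just)
open import Data.Nat hiding (_/_)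
open import Data.Nat.Combinatorics hiding (_P_)
open import Data.Nat.DivMod using (_/_; m/n*n≡m)
open import Data.Nat.Properties
open import Data.Nat.Tactic.RingSolver using (solve-∀)
open import Data.Product using (_×_; _,_; ∃-syntax; proj₂)
import Data.Rational as ℚ
import Data.Rational.Properties as ℚ
import Data.Rational.Unnormalised as ℚᵘ
import Data.Rational.Unnormalised.Properties as ℚᵘ
open import Data.Sum as Sum using (_⊎_; inj₁; inj₂)
open import Data.Vec using (Vec; []; _∷_; _++_; take; drop; splitAt)
open import Data.Vec.Properties using (count≤n)
open import Data.Vec.Relation.Binary.Pointwise.Inductive as Vecwise using ([]; _∷_)
open import Function using (_∘_)
open import Relation.Binary.PropositionalEquality
import Relation.Binary.Reasoning.Setoid as ≃-Reasoning
open import Relation.Nullary using (¬_; Dec; yes; no; contradiction)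
open import Relation.Nullary.Decidable using (_×-dec_; _⊎-dec_)

-- Sets of leaves inducing a given tree

≅-trans : ∀ {s t u} → s ≅ t → t ≅ u → s ≅ u
≅-trans (iso π f) (iso ρ g) = iso (π Perm.∘ₚ ρ) λ i → ≅-trans (f i) (g (π Perm.⟨$⟩ʳ i))

vertex-cong : ∀ {ts us} → Listwise.Pointwise _≅_ ts us → vertex ts ≅ vertex us
vertex-cong []        = iso Perm.id λ ()
vertex-cong (e ∷ es) with vertex-cong es
... | iso π f = iso (Perm.lift₀ π) λ { zero → e ; (suc i) → f i }

mutual
  ≅-refl : ∀ t → t ≅ t
  ≅-refl (vertex ts) = vertex-cong (≅-reflₗ ts)

  ≅-reflₗ : ∀ ts → Listwise.Pointwise _≅_ ts ts
  ≅-reflₗ []       = []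
  ≅-reflₗ (t ∷ ts) = ≅-refl t ∷ ≅-reflₗ ts

vertex-swap : ∀ t u → vertex (t ∷ u ∷ []) ≅ vertex (u ∷ t ∷ [])
vertex-swap t u = iso (Perm.swap Perm.id) λ { zero → ≅-refl t ; (suc zero) → ≅-refl u }

-- `suppress` itself contracts the chain of single-child vertices above the most recent common
-- ancestor, so rerooting can be ignored from here on.
suppress-rerootAtMRCA : ∀ t → suppress (rerootAtMRCA t) ≡ suppress t
suppress-rerootAtMRCA (vertex [])          = refl
suppress-rerootAtMRCA (vertex (t ∷ []))    = suppress-rerootAtMRCA t
suppress-rerootAtMRCA (vertex (_ ∷ _ ∷ _)) = refl

size-star : ∀ k .{{_ : NonZero k}} → ∣ star k ∣ ≡ k
size-star (suc k) = cong suc (go k)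
  where
  go : ∀ k → ∣ replicate k leaf ∣ₗ ≡ k
  go zero    = refl
  go (suc k) = cong suc (go k)

size-caterpillar : ∀ k .{{_ : NonZero k}} → ∣ caterpillar k ∣ ≡ k
size-caterpillar k = proj₂ (caterpillar-topological k)

take-++ : ∀ {A : Set} {m n} (xs : Vec A m) (ys : Vec A n) → take m (xs ++ ys) ≡ xs
take-++ []       ys = refl
take-++ (x ∷ xs) ys = cong (x ∷_) (take-++ xs ys)

drop-++ : ∀ {A : Set} {m n} (xs : Vec A m) (ys : Vec A n) → drop m (xs ++ ys) ≡ ys
drop-++ []       ys = refl
drop-++ (x ∷ xs) ys = drop-++ xs ys

♯-++ : ∀ {m n} (K : Subset m) (L : Subset n) → ♯ (K ++ L) ≡ ♯ K + ♯ L
♯-++ []            L = refl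
♯-++ (outside ∷ K) L = ♯-++ K L
♯-++ (inside ∷ K)  L = cong suc (♯-++ K L)

♯-++-right : ∀ {m n b} (K : Subset m) (L : Subset n) → ¬ (0 < ♯ K) → b < ♯ (K ++ L) → b < ♯ L
♯-++-right {b = b} K L ¬0<K b< =
  subst (b <_) (trans (♯-++ K L) (cong (_+ ♯ L) (n≤0⇒n≡0 (≮⇒≥ ¬0<K)))) b<

♯-++-left : ∀ {m n b} (K : Subset m) (L : Subset n) → ¬ (0 < ♯ L) → b < ♯ (K ++ L) → b < ♯ K
♯-++-left {b = b} K L ¬0<L b< = subst (b <_)
  (trans (♯-++ K L) (trans (cong (λ l → ♯ K + l) (n≤0⇒n≡0 (≮⇒≥ ¬0<L))) (+-identityʳ _))) b<

♯-++-rest : ∀ {m n a b} (K : Subset m) (L : Subset n) →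
            ¬ (a < ♯ K) → a + b < ♯ (K ++ L) → b < ♯ L
♯-++-rest {a = a} {b} K L ¬a<K a+b< = +-cancelˡ-< a b (♯ L)
  (<-≤-trans (subst (a + b <_) (♯-++ K L) a+b<) (+-monoˡ-≤ (♯ L) (≮⇒≥ ¬a<K)))

-- Trees induced by subsets of a given set of leaves

infix 4 _⊑_
_⊑_ : ∀ {n} → Subset n → Subset n → Set
_⊑_ = Vecwise.Pointwise Bool._≤_

⊥⊑ : ∀ {n} (L : Subset n) → ⊥ ⊑ L
⊥⊑ []            = []
⊥⊑ (outside ∷ L) = b≤b ∷ ⊥⊑ L
⊥⊑ (inside ∷ L)  = f≤t ∷ ⊥⊑ L

record Contains (T : RootedTree) (L : Subset ∣ T ∣) (S : RootedTree) : Set where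
  constructor by
  field
    subset  : Subset ∣ T ∣
    within  : subset ⊑ L
    size    : ♯ subset ≡ ∣ S ∣
    induces : Induces T subset S

-- The surviving children are matched with `us` from left to right, without a permutation; children
-- that `subset` misses drop out of `rootPathsₗ`. Order is disregarded only once a root is put on
-- top.
record Containsₗ (ts : List RootedTree) (L : Subset ∣ ts ∣ₗ) (us : List RootedTree) : Set where
  constructor by
  field
    subset  : Subset ∣ ts ∣ₗ
    within  : subset ⊑ L
    size    : ♯ subset ≡ ∣ us ∣ₗ
    induces : Listwise.Pointwise _≅_ (suppressₗ (rootPathsₗ ts subset)) us

take-⊥ : ∀ m {n} → take m {n} ⊥ ≡ ⊥
take-⊥ zero    = refl
take-⊥ (suc m) = cong (outside ∷_) (take-⊥ m)

drop-⊥ : ∀ m {n} → drop m {n} ⊥ ≡ ⊥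
drop-⊥ zero    = refl
drop-⊥ (suc m) = drop-⊥ m

mutual
  rootPaths-⊥ : ∀ t → rootPaths t ⊥ ≡ nothing
  rootPaths-⊥ (vertex [])       = refl
  rootPaths-⊥ (vertex (t ∷ ts)) rewrite rootPathsₗ-⊥ (t ∷ ts) = refl

  rootPathsₗ-⊥ : ∀ ts → rootPathsₗ ts ⊥ ≡ []
  rootPathsₗ-⊥ []       = refl
  rootPathsₗ-⊥ (t ∷ ts) rewrite take-⊥ ∣ t ∣ {∣ ts ∣ₗ} | drop-⊥ ∣ t ∣ {∣ ts ∣ₗ}
    | rootPaths-⊥ t = rootPathsₗ-⊥ ts

none : ∀ ts L → Containsₗ ts L []
none ts L = by ⊥ (⊥⊑ L) (∣⊥∣≡0 ∣ ts ∣ₗ)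
  (subst (λ us → Listwise.Pointwise _≅_ (suppressₗ us) []) (sym (rootPathsₗ-⊥ ts)) [])

-- Containments in forests are built from left to right out of `none`, `keep` and `skip`: each child
-- contributes one piece or the empty set, whose root paths are `nothing`.
keep : ∀ {t ts S us} {L : Subset ∣ t ∣} {M : Subset ∣ ts ∣ₗ} →
       Contains t L S → Containsₗ ts M us → Containsₗ (t ∷ ts) (L ++ M) (S ∷ us)
keep {t} {ts} {S} {us} (by K K⊑L ♯K e) (by K′ K′⊑M ♯K′ es) =
  by (K ++ K′) (Vecwise.++⁺ K⊑L K′⊑M) (trans (♯-++ K K′) (cong₂ _+_ ♯K ♯K′)) (isos e)
  where
  isos : Induces t K S →
         Listwise.Pointwise _≅_ (suppressₗ (rootPathsₗ (t ∷ ts) (K ++ K′))) (S ∷ us)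
  isos e rewrite take-++ K K′ | drop-++ K K′ with rootPaths t K | e
  ... | just r | just r≅S = subst (_≅ S) (suppress-rerootAtMRCA r) r≅S ∷ es

skip : ∀ {t ts us} (L : Subset ∣ t ∣) {M : Subset ∣ ts ∣ₗ} →
       Containsₗ ts M us → Containsₗ (t ∷ ts) (L ++ M) us
skip {t} {ts} {us} L (by K K⊑M ♯K es) =
  by (⊥ ++ K) (Vecwise.++⁺ (⊥⊑ L) K⊑M)
    (trans (♯-++ (⊥ {n = ∣ t ∣}) K) (cong₂ _+_ (∣⊥∣≡0 ∣ t ∣) ♯K)) isos
  where
  isos : Listwise.Pointwise _≅_ (suppressₗ (rootPathsₗ (t ∷ ts) (⊥ {n = ∣ t ∣} ++ K))) us
  isos rewrite take-++ (⊥ {n = ∣ t ∣}) K | drop-++ (⊥ {n = ∣ t ∣}) K | rootPaths-⊥ t = es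

-- Only one child survives, so the root has outdegree 1 and suppression erases it.
pass : ∀ {t ts L S} → Containsₗ (t ∷ ts) L (S ∷ []) → Contains (vertex (t ∷ ts)) L S
pass {t} {ts} {L} {S} (by K K⊑L ♯K es) =
  by K K⊑L (trans ♯K (+-identityʳ _)) (induces es)
  where
  induces : Listwise.Pointwise _≅_ (suppressₗ (rootPathsₗ (t ∷ ts) K)) (S ∷ []) →
            Induces (vertex (t ∷ ts)) K S
  induces es with rootPathsₗ (t ∷ ts) K | es
  ... | r ∷ [] | r≅S ∷ [] = just (subst (_≅ S) (sym (suppress-rerootAtMRCA r)) r≅S)

-- At least two children survive, so the root is the most recent common ancestor and stays as a
-- branching.
join : ∀ {t ts L u v us} → Containsₗ (t ∷ ts) L (u ∷ v ∷ us) →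
       Contains (vertex (t ∷ ts)) L (vertex (u ∷ v ∷ us))
join {t} {ts} {L} {u} {v} {us} (by K K⊑L ♯K es) = by K K⊑L ♯K (induces es)
  where
  induces : Listwise.Pointwise _≅_ (suppressₗ (rootPathsₗ (t ∷ ts) K)) (u ∷ v ∷ us) →
            Induces (vertex (t ∷ ts)) K (vertex (u ∷ v ∷ us))
  induces es with rootPathsₗ (t ∷ ts) K | es
  ... | _ ∷ []    | _ ∷ ()
  ... | _ ∷ _ ∷ _ | isos = just (vertex-cong isos)

Contains-resp-≅ : ∀ {T L S S′} → ∣ S ∣ ≡ ∣ S′ ∣ → S ≅ S′ → Contains T L S → Contains T L S′
Contains-resp-≅ size S≅S′ (by K K⊑L ♯K e) =
  by K K⊑L (trans ♯K size) (MaybeAny.map (λ r≅S → ≅-trans r≅S S≅S′) e)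

mutual
  contains-leaf : ∀ T {L} → 0 < ♯ L → Contains T L leaf
  contains-leaf (vertex []) {inside ∷ []} _ = by (inside ∷ []) (b≤b ∷ []) refl (just (≅-refl leaf))
  contains-leaf (vertex []) {outside ∷ []} ()
  contains-leaf (vertex (t ∷ ts)) 0<L = pass (contains-leafₗ (t ∷ ts) 0<L)

  contains-leafₗ : ∀ ts {L} → 0 < ♯ L → Containsₗ ts L (leaf ∷ [])
  contains-leafₗ []       {[]} ()
  contains-leafₗ (t ∷ ts) {L} 0<L with splitAt ∣ t ∣ L
  ... | M , M′ , refl with 0 <? ♯ M
  ...   | yes 0<M = keep (contains-leaf t 0<M) (none ts M′)
  ...   | no ¬0<M = skip M (contains-leafₗ ts (♯-++-right M M′ ¬0<M 0<L))

-- Unavoidability of a star or a caterpillar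

RootedTree-ind : ∀ {P : RootedTree → Set} → (∀ ts → All P ts → P (vertex ts)) → ∀ T → P T
RootedTree-ind {P} step = tree
  where
  tree   : ∀ T → P T
  forest : ∀ ts → All P ts
  tree (vertex ts) = step ts (forest ts)
  forest []        = []
  forest (t ∷ ts)  = tree t ∷ forest ts

-- Pieces found in the children of a vertex yield `S` in two ways: a single piece passes through the
-- suppressed root, or several are joined there, up to reordering.
data Assembles (S : RootedTree) : List RootedTree → Set where
  sole    : Assembles S (S ∷ [])
  several : ∀ {u v us} → ∣ u ∷ v ∷ us ∣ₗ ≡ ∣ S ∣ → vertex (u ∷ v ∷ us) ≅ S →
            Assembles S (u ∷ v ∷ us)

ContainsPieces : ∀ ts → Subset ∣ ts ∣ₗ → RootedTree → Set
ContainsPieces ts L S = ∃[ us ] (Assembles S us × Containsₗ ts L us)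

assemble : ∀ {t ts L S} → ContainsPieces (t ∷ ts) L S → Contains (vertex (t ∷ ts)) L S
assemble (_ , sole , p)            = pass p
assemble (_ , several size ≅S , p) = Contains-resp-≅ size ≅S (join p)

skipPieces : ∀ {t ts S} (L : Subset ∣ t ∣) {M : Subset ∣ ts ∣ₗ} →
             ContainsPieces ts M S → ContainsPieces (t ∷ ts) (L ++ M) S
skipPieces L (us , a , p) = us , a , skip L p

onlyChild : ∀ {t ts S L} (M : Subset ∣ ts ∣ₗ) →
            Contains t L S → ContainsPieces (t ∷ ts) (L ++ M) S
onlyChild M p = _ , sole , keep p (none _ M)

-- A tree of height less than h all of whose outdegrees are at most m has at
-- most bound m h leaves.
bound : ℕ → ℕ → ℕ
bound m zero    = 0
bound m (suc h) = m ^ h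

-- One more level multiplies the bound by `m`. At `h = 0` the two sides are 0 and 1; otherwise they
-- agree.
m*bound≤bound : ∀ m h → m * bound m h ≤ bound m (suc h)
m*bound≤bound m zero    = ≤-trans (≤-reflexive (*-zeroʳ m)) z≤n
m*bound≤bound m (suc h) = ≤-refl

module _ (m : ℕ) where

  private
    m⁺ = suc m
    Star = star (suc m⁺)

  StarOrCaterpillar : (RootedTree → Set) → ℕ → Set
  StarOrCaterpillar P h = P Star ⊎ P (caterpillar h)

  -- `L` and `h` stay general for the induction: below a root with one child meeting `L` the same
  -- `h` is used again, below a branching `h` drops by one and `L` shrinks to its part in a child.
  Unavoidable : RootedTree → Set
  Unavoidable T = ∀ L h → bound m⁺ h < ♯ L → StarOrCaterpillar (Contains T L) (suc h)

  -- If more than n children meet L, they supply a transversal; otherwise one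
  -- of them carries more than bound m⁺ h leaves of L.
  pigeonhole : ∀ n h {ts} → All Unavoidable ts → ∀ L → n * bound m⁺ h < ♯ L →
               Containsₗ ts L (replicate (suc n) leaf) ⊎
               StarOrCaterpillar (λ S → Containsₗ ts L (S ∷ [])) (suc h)
  pigeonhole zero    h _ L 0<L = inj₁ (contains-leafₗ _ 0<L)
  pigeonhole (suc n) h [] [] ()
  pigeonhole (suc n) h {t ∷ ts} (ih ∷ ihs) L nb<L with splitAt ∣ t ∣ L
  ... | M , M′ , refl with bound m⁺ h <? ♯ M
  ...   | yes b<M =
    inj₂ (Sum.map (λ p → keep p (none ts M′)) (λ p → keep p (none ts M′)) (ih M h b<M))
  ...   | no ¬b<M with 0 <? ♯ M
  ...     | no ¬0<M =
    Sum.map (skip M) (Sum.map (skip M) (skip M))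
      (pigeonhole (suc n) h ihs M′ (♯-++-right M M′ ¬0<M nb<L))
  -- This child gives one leaf to the transversal and uses up at most `bound m⁺ h` leaves of `L`, so
  -- more than `n * bound m⁺ h` remain.
  ...     | yes 0<M =
    Sum.map (keep (contains-leaf t 0<M)) (Sum.map (skip M) (skip M))
      (pigeonhole n h ihs M′ (♯-++-rest M M′ ¬b<M nb<L))

  -- If only one child meets `L`, the induction hypothesis applies there with the same height.
  -- Otherwise a child rich in leaves of `L` supplies a shorter caterpillar, to which a leaf from
  -- another child is joined; if no rich child is found, the transversal is a star.
  unavoidable-forest : ∀ {ts} → All Unavoidable ts → ∀ L h → bound m⁺ (suc h) < ♯ L →
                       StarOrCaterpillar (ContainsPieces ts L) (suc (suc h))
  unavoidable-forest [] [] h ()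
  unavoidable-forest {t ∷ ts} (ih ∷ ihs) L h b<L with splitAt ∣ t ∣ L
  ... | M , M′ , refl with 0 <? ♯ M | 0 <? ♯ M′
  ...   | no ¬0<M | _ =
    Sum.map (skipPieces M) (skipPieces M)
      (unavoidable-forest ihs M′ h (♯-++-right M M′ ¬0<M b<L))
  ...   | yes _ | no ¬0<M′ =
    Sum.map (onlyChild M′) (onlyChild M′) (ih M (suc h) (♯-++-left M M′ ¬0<M′ b<L))
  ...   | yes 0<M | yes 0<M′ with bound m⁺ h <? ♯ M
  -- The caterpillar lies to the left of the added leaf, opposite to the order in `caterpillar`;
  -- hence the swap.
  ...     | yes b<M =
    Sum.map (onlyChild M′)
      (λ p → _ , several (size-swap (suc h)) (vertex-swap _ leaf) , keep p (contains-leafₗ ts 0<M′))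
      (ih M h b<M)
    where
    size-swap : ∀ h → ∣ caterpillar h ∷ leaf ∷ [] ∣ₗ ≡ ∣ leaf ∷ caterpillar h ∷ [] ∣ₗ
    size-swap h = trans (+-comm ∣ caterpillar h ∣ 1) (cong suc (sym (+-identityʳ _)))
  -- Of the `m⁺` portions of size `bound m⁺ h`, the first child accounts for at most one. A
  -- transversal of `m⁺` leaves in the remaining children and a leaf of the first make up the star.
  ...     | no ¬b<M with pigeonhole m h ihs M′
                           (♯-++-rest M M′ ¬b<M (≤-<-trans (m*bound≤bound m⁺ h) b<L))
  ...       | inj₁ p        =
    inj₁ (_ , several refl (≅-refl Star) , keep (contains-leaf t 0<M) p)
  ...       | inj₂ (inj₁ p) = inj₁ (_ , sole , skip M p)
  ...       | inj₂ (inj₂ p) =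
    inj₂ (_ , several refl (≅-refl _) , keep (contains-leaf t 0<M) p)

  unavoidable : ∀ T → Unavoidable T
  unavoidable = RootedTree-ind step
    where
    step : ∀ ts → All Unavoidable ts → Unavoidable (vertex ts)
    -- `bound m⁺ 0` is 0 and `caterpillar 1` is a leaf. In the next case a single vertex cannot
    -- carry more than `m⁺ ^ h` leaves, as that power is positive.
    step ts       ih L zero    0<L = inj₂ (contains-leaf (vertex ts) 0<L)
    step []       ih L (suc h) b<L =
      contradiction (<-≤-trans b<L (count≤n (Bool._≟ inside) L)) (≤⇒≯ (m^n>0 m⁺ h))
    step (t ∷ ts) ih L (suc h) b<L = Sum.map assemble assemble (unavoidable-forest ih L h b<L)

-- Binomial coefficients

[m+n]Cm*m!*n! : ∀ m n → ((m + n) C m) * (m ! * n !) ≡ (m + n) !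
[m+n]Cm*m!*n! m n = begin
  ((m + n) C m) * (m ! * n !)             ≡⟨ cong (λ r → ((m + n) C m) * (m ! * r !)) (m+n∸m≡n m n) ⟨
  ((m + n) C m) * (m ! * ((m + n) ∸ m) !) ≡⟨ cong (_* d) (nCk≡n!/k![n-k]! m≤) ⟩
  ((m + n) ! / d) {{nz}} * d              ≡⟨ m/n*n≡m {{nz}} (k![n∸k]!∣n! m≤) ⟩
  (m + n) !                               ∎
  where
  open ≡-Reasoning
  m≤ = m≤m+n m n
  d  = m ! * ((m + n) ∸ m) !
  nz = m !* ((m + n) ∸ m) !≢0

nCk≢0 : ∀ {n k} → k ≤ n → NonZero (n C k)
nCk≢0 {k = k} k≤n with m≤n⇒∃[o]m+o≡n k≤n
... | r , refl = ≢-nonZero λ eq → ≢-nonZero⁻¹ ((k + r) !) {{(k + r) !≢0}}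
  (trans (sym ([m+n]Cm*m!*n! k r)) (cong (_* (k ! * r !)) eq))

-- Multiplied by `k ! * j ! * r !`, either side becomes `(k + j + r) !`.
trinomial-revision : ∀ k j r →
  ((k + j + r) C (k + j)) * ((k + j) C k) ≡ ((k + j + r) C k) * ((j + r) C j)
trinomial-revision k j r = *-cancelʳ-≡ _ _ (k ! * j ! * r !)
  {{m*n≢0 _ _ {{k !* j !≢0}} {{r !≢0}}}} (begin
    A * B * (k ! * j ! * r !)     ≡⟨ shuffle₁ A B (k !) (j !) (r !) ⟩
    A * (B * (k ! * j !) * r !)   ≡⟨ cong (λ x → A * (x * r !)) ([m+n]Cm*m!*n! k j) ⟩
    A * ((k + j) ! * r !)         ≡⟨ [m+n]Cm*m!*n! (k + j) r ⟩
    (k + j + r) !                 ≡⟨ cong _! (+-assoc k j r) ⟩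
    (k + (j + r)) !               ≡⟨ [m+n]Cm*m!*n! k (j + r) ⟨
    ((k + (j + r)) C k) * (k ! * (j + r) !) ≡⟨ cong (λ x → (x C k) * (k ! * (j + r) !)) (+-assoc k j r) ⟨
    E * (k ! * (j + r) !)         ≡⟨ cong (λ x → E * (k ! * x)) ([m+n]Cm*m!*n! j r) ⟨
    E * (k ! * (F * (j ! * r !))) ≡⟨ shuffle₂ E F (k !) (j !) (r !) ⟩
    E * F * (k ! * j ! * r !)     ∎)
  where
  open ≡-Reasoning
  A = (k + j + r) C (k + j)
  B = (k + j) C k
  E = (k + j + r) C k
  F = (j + r) C j
  shuffle₁ : ∀ A B x y z → A * B * (x * y * z) ≡ A * (B * (x * y) * z)
  shuffle₁ = solve-∀
  shuffle₂ : ∀ A B x y z → A * (x * (B * (y * z))) ≡ A * B * (x * y * z)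
  shuffle₂ = solve-∀

-- Each of the `k` largest factors of the factorial is at most `k + r`.
[k+r]!≤[k+r]^k*r! : ∀ k r → (k + r) ! ≤ (k + r) ^ k * r !
[k+r]!≤[k+r]^k*r! zero    r = ≤-reflexive (sym (+-identityʳ (r !)))
[k+r]!≤[k+r]^k*r! (suc k) r = begin
  (suc k + r) * (k + r) !                ≤⟨ *-monoʳ-≤ (suc k + r) ([k+r]!≤[k+r]^k*r! k r) ⟩
  (suc k + r) * ((k + r) ^ k * r !)
    ≤⟨ *-monoʳ-≤ (suc k + r) (*-monoˡ-≤ (r !) (^-monoˡ-≤ k (n≤1+n (k + r)))) ⟩
  (suc k + r) * ((suc k + r) ^ k * r !)  ≡⟨ *-assoc (suc k + r) ((suc k + r) ^ k) (r !) ⟨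
  (suc k + r) ^ suc k * r !              ∎
  where open ≤-Reasoning

k!*nCk≤n^k : ∀ {n k} → k ≤ n → k ! * (n C k) ≤ n ^ k
k!*nCk≤n^k {k = k} k≤n with m≤n⇒∃[o]m+o≡n k≤n
... | r , refl = *-cancelʳ-≤ _ _ (r !) {{r !≢0}} (begin
  k ! * ((k + r) C k) * r !    ≡⟨ shuffle (k !) ((k + r) C k) (r !) ⟩
  ((k + r) C k) * (k ! * r !)  ≡⟨ [m+n]Cm*m!*n! k r ⟩
  (k + r) !                    ≤⟨ [k+r]!≤[k+r]^k*r! k r ⟩
  (k + r) ^ k * r !            ∎)
  where
  open ≤-Reasoning
  shuffle : ∀ x y z → x * y * z ≡ y * (x * z)
  shuffle = solve-∀

-- Averaging over the subsets of a finite set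

∑ : ∀ {n} → (Subset n → ℕ) → ℕ
∑ {zero}  f = f []
∑ {suc n} f = ∑ (f ∘ (outside ∷_)) + ∑ (f ∘ (inside ∷_))

∑-cong : ∀ {n} {f g : Subset n → ℕ} → (∀ L → f L ≡ g L) → ∑ f ≡ ∑ g
∑-cong {zero}  f≡g = f≡g []
∑-cong {suc n} f≡g = cong₂ _+_ (∑-cong (f≡g ∘ (outside ∷_))) (∑-cong (f≡g ∘ (inside ∷_)))

∑-mono : ∀ {n} {f g : Subset n → ℕ} → (∀ L → f L ≤ g L) → ∑ f ≤ ∑ g
∑-mono {zero}  f≤g = f≤g []
∑-mono {suc n} f≤g = +-mono-≤ (∑-mono (f≤g ∘ (outside ∷_))) (∑-mono (f≤g ∘ (inside ∷_)))

∑-+ : ∀ {n} (f g : Subset n → ℕ) → ∑ (λ L → f L + g L) ≡ ∑ f + ∑ g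
∑-+ {zero}  f g = refl
∑-+ {suc n} f g = trans (cong₂ _+_ (∑-+ {n} _ _) (∑-+ {n} _ _)) (interchange (∑ {n} _) _ _ _)
  where
  interchange : ∀ a b c d → a + b + (c + d) ≡ a + c + (b + d)
  interchange = solve-∀

∑-*ʳ : ∀ {n} (f : Subset n → ℕ) a → ∑ (λ L → f L * a) ≡ ∑ f * a
∑-*ʳ {zero}  f a = refl
∑-*ʳ {suc n} f a = trans (cong₂ _+_ (∑-*ʳ {n} _ a) (∑-*ʳ {n} _ a)) (sym (*-distribʳ-+ a (∑ {n} _) _))

∑-*ˡ : ∀ {n} a (f : Subset n → ℕ) → ∑ (λ L → a * f L) ≡ a * ∑ f
∑-*ˡ a f = trans (∑-cong λ L → *-comm a (f L)) (trans (∑-*ʳ f a) (*-comm (∑ f) a))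

∑-swap : ∀ {m n} (f : Subset m → Subset n → ℕ) →
         ∑ (λ K → ∑ λ L → f K L) ≡ ∑ (λ L → ∑ λ K → f K L)
∑-swap {zero}  f = refl
∑-swap {suc m} f = trans
  (cong₂ _+_ (∑-swap (f ∘ (outside ∷_))) (∑-swap (f ∘ (inside ∷_))))
  (sym (∑-+ (λ L → ∑ λ K → f (outside ∷ K) L) (λ L → ∑ λ K → f (inside ∷ K) L)))

term≤∑ : ∀ {n} (f : Subset n → ℕ) K → f K ≤ ∑ f
term≤∑ f []            = ≤-refl
term≤∑ f (outside ∷ K) = ≤-trans (term≤∑ (f ∘ (outside ∷_)) K) (m≤m+n _ _)
term≤∑ f (inside ∷ K)  = ≤-trans (term≤∑ (f ∘ (inside ∷_)) K) (m≤n+m _ _)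

𝟙 : ∀ {A : Set} → Dec A → ℕ
𝟙 (yes _) = 1
𝟙 (no _)  = 0

𝟙-yes : ∀ {A : Set} (d : Dec A) → A → 𝟙 d ≡ 1
𝟙-yes (yes _) _ = refl
𝟙-yes (no ¬a) a = contradiction a ¬a

length-filter-subsets : ∀ {n} {P : Subset n → Set} (P? : ∀ L → Dec (P L)) →
                        length (filter P? (subsets n)) ≡ ∑ (λ L → 𝟙 (P? L))
length-filter-subsets {zero} P? with P? []
... | yes _ = refl
... | no _  = refl
length-filter-subsets {suc n} P? = begin
  length (filter P? (List.map (outside ∷_) (subsets n) List.++ List.map (inside ∷_) (subsets n)))
    ≡⟨ cong length (filter-++ P? (List.map (outside ∷_) (subsets n)) _) ⟩
  length (filter P? (List.map (outside ∷_) (subsets n)) List.++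
          filter P? (List.map (inside ∷_) (subsets n)))
    ≡⟨ length-++ (filter P? (List.map (outside ∷_) (subsets n))) ⟩
  length (filter P? (List.map (outside ∷_) (subsets n))) +
  length (filter P? (List.map (inside ∷_) (subsets n)))
    ≡⟨ cong₂ _+_ (length-filter-map (outside ∷_) (subsets n))
                 (length-filter-map (inside ∷_) (subsets n)) ⟩
  length (filter (P? ∘ (outside ∷_)) (subsets n)) + length (filter (P? ∘ (inside ∷_)) (subsets n))
    ≡⟨ cong₂ _+_ (length-filter-subsets (P? ∘ (outside ∷_)))
                 (length-filter-subsets (P? ∘ (inside ∷_))) ⟩
  ∑ (λ L → 𝟙 (P? L)) ∎
  where
  open ≡-Reasoning
  length-filter-map : ∀ (f : Subset n → Subset (suc n)) Ls →
                      length (filter P? (List.map f Ls)) ≡ length (filter (P? ∘ f) Ls)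
  length-filter-map f List.[] = refl
  length-filter-map f (L List.∷ Ls) with P? (f L)
  ... | yes _ = cong suc (length-filter-map f Ls)
  ... | no _  = length-filter-map f Ls

-- The indicator of K ⊑ M and ♯ M ≡ ♯ K + j.
χ : ∀ {n} → Subset n → ℕ → Subset n → ℕ
χ []            zero    []            = 1
χ []            (suc j) []            = 0
χ (outside ∷ K) j       (outside ∷ M) = χ K j M
χ (outside ∷ K) zero    (inside ∷ M)  = 0
χ (outside ∷ K) (suc j) (inside ∷ M)  = χ K j M
χ (inside ∷ K)  j       (outside ∷ M) = 0
χ (inside ∷ K)  j       (inside ∷ M)  = χ K j M

∑-zero : ∀ n → ∑ {n} (λ _ → 0) ≡ 0
∑-zero n = trans (∑-*ʳ {n} (λ _ → 0) 0) (*-zeroʳ (∑ {n} λ _ → 0))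

-- The `j` further elements are chosen freely outside `K`; an element outside `K` is taken or not,
-- which is Pascal's rule.
∑χ : ∀ {n} (K : Subset n) j → ∑ (χ K j) ≡ (n ∸ ♯ K) C j
∑χ []                    zero    = refl
∑χ []                    (suc j) = refl
∑χ {suc n} (outside ∷ K) zero    = cong₂ _+_ (∑χ K 0) (∑-zero n)
∑χ {suc n} (outside ∷ K) (suc j) = begin
  ∑ (χ K (suc j)) + ∑ (χ K j)             ≡⟨ cong₂ _+_ (∑χ K (suc j)) (∑χ K j) ⟩
  (n ∸ ♯ K) C suc j + (n ∸ ♯ K) C j       ≡⟨ +-comm ((n ∸ ♯ K) C suc j) _ ⟩
  (n ∸ ♯ K) C j + (n ∸ ♯ K) C suc j       ≡⟨ nCk+nC[k+1]≡[n+1]C[k+1] (n ∸ ♯ K) j ⟩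
  suc (n ∸ ♯ K) C suc j                   ≡⟨ cong (_C suc j) (+-∸-assoc 1 (count≤n _ K)) ⟨
  (suc n ∸ ♯ K) C suc j                   ∎
  where open ≡-Reasoning
∑χ {suc n} (inside ∷ K)  j       = cong₂ _+_ (∑-zero n) (∑χ K j)

χ≡1 : ∀ {n} {K M : Subset n} → K ⊑ M → ∃[ j ] (♯ M ≡ ♯ K + j × χ K j M ≡ 1)
χ≡1 [] = 0 , refl , refl
χ≡1 (f≤t ∷ K⊑M) with χ≡1 K⊑M
... | j , eq , χ = suc j , trans (cong suc eq) (sym (+-suc _ j)) , χ
χ≡1 (b≤b {false} ∷ K⊑M) = χ≡1 K⊑M
χ≡1 (b≤b {true} ∷ K⊑M) with χ≡1 K⊑M
... | j , eq , χ = j , cong suc eq , χ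

-- `χ ⊥ m` is the indicator of the `m`-sets, so a lower bound has to be checked on those only.
χ-⊥-≤ : ∀ {n} m (M : Subset n) {x} → (♯ M ≡ m → 1 ≤ x) → χ ⊥ m M ≤ x
χ-⊥-≤ zero    []            1≤x = 1≤x refl
χ-⊥-≤ (suc m) []            1≤x = z≤n
χ-⊥-≤ m       (outside ∷ M) 1≤x = χ-⊥-≤ m M 1≤x
χ-⊥-≤ zero    (inside ∷ M)  1≤x = z≤n
χ-⊥-≤ (suc m) (inside ∷ M)  1≤x = χ-⊥-≤ m M (1≤x ∘ cong suc)

-- Double counting of pairs `K ⊑ M` with `K` a `k`-set satisfying `P` and `M` a `(k + j)`-set: every
-- `M` has such a `K`, and every `K` lies in `(n ∸ k) C j` sets `M`.
averaging : ∀ {n} k j {P : Subset n → Set} (P? : ∀ K → Dec (P K)) →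
            (∀ M → ♯ M ≡ k + j → ∃[ K ] (K ⊑ M × ♯ K ≡ k × P K)) →
            n C (k + j) ≤ length (filter P? (subsets n)) * ((n ∸ k) C j)
averaging {n} k j {P} P? extract = begin
  n C (k + j)                                ≡⟨ cong (λ x → (n ∸ x) C (k + j)) (∣⊥∣≡0 n) ⟨
  (n ∸ ♯ (⊥ {n})) C (k + j)                  ≡⟨ ∑χ {n} ⊥ (k + j) ⟨
  ∑ (χ {n} ⊥ (k + j))                        ≤⟨ ∑-mono (λ M → χ-⊥-≤ (k + j) M (extracted M)) ⟩
  ∑ (λ M → ∑ λ K → w K * χ K j M)            ≡⟨ ∑-swap (λ K M → w K * χ K j M) ⟨
  ∑ (λ K → ∑ λ M → w K * χ K j M)            ≡⟨ ∑-cong (λ K → ∑-*ˡ (w K) (χ K j)) ⟩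
  ∑ (λ K → w K * ∑ (χ K j))                  ≤⟨ ∑-mono weight ⟩
  ∑ (λ K → 𝟙 (P? K) * ((n ∸ k) C j))         ≡⟨ ∑-*ʳ (λ K → 𝟙 (P? K)) ((n ∸ k) C j) ⟩
  ∑ (λ K → 𝟙 (P? K)) * ((n ∸ k) C j)         ≡⟨ cong (_* ((n ∸ k) C j)) (length-filter-subsets P?) ⟨
  length (filter P? (subsets n)) * ((n ∸ k) C j) ∎
  where
  open ≤-Reasoning
  -- Restricting the size makes `∑ (χ K j)` the same binomial for every `K` of nonzero weight;
  -- `weight` then drops the restriction.
  w : Subset n → ℕ
  w K = 𝟙 (♯ K ≟ k ×-dec P? K)

  weight : ∀ K → w K * ∑ (χ K j) ≤ 𝟙 (P? K) * ((n ∸ k) C j)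
  weight K with ♯ K ≟ k | P? K
  ... | no _     | _     = z≤n
  ... | yes _    | no _  = z≤n
  ... | yes refl | yes _ = *-monoʳ-≤ 1 (≤-reflexive (∑χ K j))

  extracted : ∀ M → ♯ M ≡ k + j → 1 ≤ ∑ (λ K → w K * χ K j M)
  extracted M ♯M with extract M ♯M
  ... | K , K⊑M , ♯K , p with χ≡1 K⊑M
  -- The surplus `j′` of `M` over `K` is `j`, by comparing sizes.
  ...   | j′ , eq , χ≡ with +-cancelˡ-≡ k j j′ (trans (sym ♯M) (trans eq (cong (_+ j′) ♯K)))
  ...     | refl = begin
    1                       ≡⟨ cong₂ _*_ (𝟙-yes (♯ K ≟ k ×-dec P? K) (♯K , p)) χ≡ ⟨
    w K * χ K j M           ≤⟨ term≤∑ (λ K → w K * χ K j M) K ⟩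
    ∑ (λ K → w K * χ K j M) ∎

-- With `j = N - k` and `r = n - N`, trinomial revision turns `averaging` into an inequality with
-- the positive common factor `(j + r) C j`, which cancels.
unavoidable⇒dense : ∀ {n k N} {P : Subset n → Set} (P? : ∀ K → Dec (P K)) → k ≤ N → N ≤ n →
                    (∀ M → ♯ M ≡ N → ∃[ K ] (K ⊑ M × ♯ K ≡ k × P K)) →
                    n C k ≤ length (filter P? (subsets n)) * (N C k)
unavoidable⇒dense {k = k} P? k≤N N≤n extract with m≤n⇒∃[o]m+o≡n k≤N
... | j , refl with m≤n⇒∃[o]m+o≡n N≤n
...   | r , refl = *-cancelʳ-≤ _ _ ((j + r) C j) {{nCk≢0 (m≤m+n j r)}} (begin
  (n C k) * ((j + r) C j)              ≡⟨ trinomial-revision k j r ⟨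
  (n C (k + j)) * ((k + j) C k)        ≤⟨ *-monoˡ-≤ ((k + j) C k) (averaging k j P? extract) ⟩
  x * ((n ∸ k) C j) * ((k + j) C k)    ≡⟨ cong (λ i → x * (i C j) * ((k + j) C k)) n∸k≡j+r ⟩
  x * ((j + r) C j) * ((k + j) C k)    ≡⟨ shuffle x ((j + r) C j) ((k + j) C k) ⟩
  x * ((k + j) C k) * ((j + r) C j)    ∎)
  where
  open ≤-Reasoning
  n = k + j + r
  x = length (filter P? (subsets n))
  n∸k≡j+r : n ∸ k ≡ j + r
  n∸k≡j+r = trans (cong (_∸ k) (+-assoc k j r)) (m+n∸m≡n k (j + r))
  shuffle : ∀ x y z → x * y * z ≡ x * z * y
  shuffle = solve-∀

-- A set with both properties is counted twice on the right, as happens for `k = 2`, where star and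
-- caterpillar coincide.
count-⊎ : ∀ {n} {P Q : Subset n → Set} (P? : ∀ L → Dec (P L)) (Q? : ∀ L → Dec (Q L)) →
          length (filter (λ L → P? L ⊎-dec Q? L) (subsets n)) ≤
          length (filter P? (subsets n)) + length (filter Q? (subsets n))
count-⊎ {n} P? Q? = begin
  length (filter (λ L → P? L ⊎-dec Q? L) (subsets n))
    ≡⟨ length-filter-subsets (λ L → P? L ⊎-dec Q? L) ⟩
  ∑ (λ L → 𝟙 (P? L ⊎-dec Q? L))
    ≤⟨ ∑-mono (λ L → 𝟙-⊎ (P? L) (Q? L)) ⟩
  ∑ (λ L → 𝟙 (P? L) + 𝟙 (Q? L))
    ≡⟨ ∑-+ (λ L → 𝟙 (P? L)) (λ L → 𝟙 (Q? L)) ⟩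
  ∑ (λ L → 𝟙 (P? L)) + ∑ (λ L → 𝟙 (Q? L))
    ≡⟨ cong₂ _+_ (length-filter-subsets P?) (length-filter-subsets Q?) ⟨
  length (filter P? (subsets n)) + length (filter Q? (subsets n)) ∎
  where
  open ≤-Reasoning
  𝟙-⊎ : ∀ {A B : Set} (d : Dec A) (e : Dec B) → 𝟙 (d ⊎-dec e) ≤ 𝟙 d + 𝟙 e
  𝟙-⊎ (yes _) _       = s≤s z≤n
  𝟙-⊎ (no _)  (yes _) = ≤-refl
  𝟙-⊎ (no _)  (no _)  = ≤-refl

-- The densities

÷-mono-≤ : ∀ a b c d .{{_ : NonZero b}} .{{_ : NonZero d}} → a * d ≤ c * b → a ÷ b ℚ.≤ c ÷ d
÷-mono-≤ a (suc b) c (suc d) ad≤cb = ℚ.toℚᵘ-cancel-≤ (begin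
  ℚ.toℚᵘ (+ a ℚ./ suc b)  ≃⟨ ℚ.toℚᵘ-fromℚᵘ (+ a ℚᵘ./ suc b) ⟩
  + a ℚᵘ./ suc b
    ≤⟨ ℚᵘ.*≤* (subst₂ ℤ._≤_ (ℤ.pos-* a (suc d)) (ℤ.pos-* c (suc b)) (ℤ.+≤+ ad≤cb)) ⟩
  + c ℚᵘ./ suc d          ≃⟨ ℚ.toℚᵘ-fromℚᵘ (+ c ℚᵘ./ suc d) ⟨
  ℚ.toℚᵘ (+ c ℚ./ suc d)  ∎)
  where open ℚᵘ.≤-Reasoning

÷-distribʳ-+ : ∀ a b d → (a + b) ÷ d ≡ a ÷ d ℚ.+ b ÷ d
÷-distribʳ-+ a b zero    = refl
÷-distribʳ-+ a b (suc d) = ℚ.toℚᵘ-injective (begin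
  ℚ.toℚᵘ (+ (a + b) ℚ./ suc d)               ≈⟨ ℚ.toℚᵘ-fromℚᵘ (+ (a + b) ℚᵘ./ suc d) ⟩
  + (a + b) ℚᵘ./ suc d                       ≈⟨ ℚᵘ.*≡* (distrib (+ a) (+ b) (+ suc d)) ⟩
  + a ℚᵘ./ suc d ℚᵘ.+ + b ℚᵘ./ suc d
    ≈⟨ ℚᵘ.+-cong (ℚ.toℚᵘ-fromℚᵘ (+ a ℚᵘ./ suc d)) (ℚ.toℚᵘ-fromℚᵘ (+ b ℚᵘ./ suc d)) ⟨
  ℚ.toℚᵘ (+ a ℚ./ suc d) ℚᵘ.+ ℚ.toℚᵘ (+ b ℚ./ suc d)
    ≈⟨ ℚ.toℚᵘ-homo-+ (+ a ℚ./ suc d) (+ b ℚ./ suc d) ⟨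
  ℚ.toℚᵘ (+ a ℚ./ suc d ℚ.+ + b ℚ./ suc d)   ∎)
  where
  open ≃-Reasoning ℚᵘ.≃-setoid
  distrib : ∀ x y z → (x ℤ.+ y) ℤ.* (z ℤ.* z) ≡ (x ℤ.* z ℤ.+ y ℤ.* z) ℤ.* z
  distrib = ℤ-Solver.solve-∀

-- For `k ≥ 2` this is one more than `bound (k ∸ 1) (k ∸ 1)`.
threshold : ℕ → ℕ
threshold k = 1 + (k ∸ 1) ^ (k ∸ 2)

-- Equality holds at `k = 2`; beyond that the exponent `k ∸ 2` is positive. This makes the binomials
-- in the denominators nonzero.
k≤threshold : ∀ k → 2 ≤ k → k ≤ threshold k
k≤threshold (suc (suc zero))    (s≤s (s≤s _)) = ≤-refl
k≤threshold (suc (suc (suc m))) (s≤s (s≤s _)) =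
  s≤s (m≤m*n (2 + m) ((2 + m) ^ m) {{m^n≢0 (2 + m) m}})

star-or-caterpillar : ∀ k → 2 ≤ k → ∀ T M → ♯ M ≡ threshold k →
  ∃[ K ] (K ⊑ M × ♯ K ≡ k × (Induces T K (star k) ⊎ Induces T K (caterpillar k)))
star-or-caterpillar k@(suc (suc m)) (s≤s (s≤s _)) T M ♯M
  -- The height `suc m` is `k - 1`, so the caterpillar obtained has `k` leaves and `♯ M` exceeds the
  -- bound by exactly one.
  with unavoidable m T M (suc m) (≤-reflexive (sym ♯M))
... | inj₁ (by K K⊑M ♯K e) = K , K⊑M , trans ♯K (size-star k) , inj₁ e
... | inj₂ (by K K⊑M ♯K e) = K , K⊑M , trans ♯K (size-caterpillar k) , inj₂ e

density : ∀ k → 2 ≤ k → ∀ T → threshold k ≤ ∣ T ∣ →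
          1 ÷ (threshold k C k) ℚ.≤ γ (star k) T ℚ.+ γ (caterpillar k) T
density k@(suc _) 2≤k T N≤T = subst (1 ÷ (N C k) ℚ.≤_) densities
  (÷-mono-≤ 1 (N C k) (c (star k) T + c (caterpillar k) T) (∣ T ∣ C k)
    {{nCk≢0 k≤N}} {{nCk≢0 (≤-trans k≤N N≤T)}} (begin
      1 * (∣ T ∣ C k)                                 ≡⟨ *-identityˡ _ ⟩
      ∣ T ∣ C k
        ≤⟨ unavoidable⇒dense either? k≤N N≤T (star-or-caterpillar k 2≤k T) ⟩
      length (filter either? (subsets ∣ T ∣)) * (N C k)
        ≤⟨ *-monoˡ-≤ (N C k) (count-⊎ (λ L → induces? T L (star k))
                                      (λ L → induces? T L (caterpillar k))) ⟩
      (c (star k) T + c (caterpillar k) T) * (N C k)  ∎))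
  where
  open ≤-Reasoning
  N = threshold k
  k≤N = k≤threshold k 2≤k
  either? : ∀ L → Dec (Induces T L (star k) ⊎ Induces T L (caterpillar k))
  either? L = induces? T L (star k) ⊎-dec induces? T L (caterpillar k)
  densities : (c (star k) T + c (caterpillar k) T) ÷ (∣ T ∣ C k) ≡
              γ (star k) T ℚ.+ γ (caterpillar k) T
  densities = trans (÷-distribʳ-+ (c (star k) T) (c (caterpillar k) T) (∣ T ∣ C k))
    (cong₂ ℚ._+_ (cong (λ i → c (star k) T ÷ (∣ T ∣ C i)) (sym (size-star k)))
                 (cong (λ i → c (caterpillar k) T ÷ (∣ T ∣ C i)) (sym (size-caterpillar k))))

≤-minimum : ∀ {q n} f .{{_ : NonZero n}} →
            (∀ T → ∣ T ∣ ≡ n → q ℚ.≤ f T) → q ℚ.≤ minimum f n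
≤-minimum {q} {n} f q≤f = fromMinimum (minimum-isMinimum f n)
  where
  -- A variable `m` in place of `minimum f n` lets the equation with `f T` be matched by `refl`.
  fromMinimum : ∀ {m} → IsMinimum f n m → q ℚ.≤ m
  fromMinimum ((T , (_ , size) , refl) , _) = q≤f T size

proposition6 : ∀ (k : ℕ) → 2 ≤ k →
    (1 ÷ ((1 + (k ∸ 1) ^ (k ∸ 2)) C k)
    ≤liminf minimum (λ T → γ (star k) T ℚ.+ γ (caterpillar k) T))
    × ((k !) ÷ ((1 + (k ∸ 1) ^ (k ∸ 2)) ^ k)
    ℚ.≤ 1 ÷ ((1 + (k ∸ 1) ^ (k ∸ 2)) C k))
proposition6 k 2≤k =
  -- The bound itself serves as the number strictly above `q`: it holds for every `n` from
  -- `threshold k` on.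
  (λ q q<r → 1 ÷ (threshold k C k) , q<r , threshold k , eventually) ,
  ÷-mono-≤ (k !) (threshold k ^ k) 1 (threshold k C k) {{m^n≢0 (threshold k) k}} {{nCk≢0 k≤N}}
    (≤-trans (k!*nCk≤n^k k≤N) (≤-reflexive (sym (*-identityˡ _))))
  where
  k≤N = k≤threshold k 2≤k
  eventually : ∀ n → threshold k ≤ n →
    1 ÷ (threshold k C k) ℚ.≤ minimum (λ T → γ (star k) T ℚ.+ γ (caterpillar k) T) n
  eventually n N≤n = ≤-minimum (λ T → γ (star k) T ℚ.+ γ (caterpillar k) T)
    {{>-nonZero (≤-trans z<s N≤n)}} (λ { T refl → density k 2≤k T N≤n })
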